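{- Let $d\geq k\geq 1$ be integers, and let $\mathcal{H}$ be a $d$-regular $3$-uniform hypergraph. Then there is a spanning subhypergraph $\mathcal{C}\subseteq \mathcal{H}$ such that $\deg_{\mathcal{C}} v\in \{k, k+1, k+2\}$ for all $v\in V(\mathcal{H})$.
   Context: A hypergraph $\mathcal{H}$ consists of a finite vertex set $V(\mathcal{H})$ and a set $E(\mathcal{H})$ of subsets of $V(\mathcal{H})$, called edges. It is $r$-uniform if every edge has exactly $r$ vertices. The degree $\deg_{\mathcal{H}} v$ of a vertex $v$ is the number of edges containing $v$; $\mathcal{H}$ is $d$-regular if every vertex has degree $d$. A spanning subhypergraph $\mathcal{C}\subseteq\mathcal{H}$ is a hypergraph with $V(\mathcal{C})=V(\mathcal{H})$ and $E(\mathcal{C})\subseteq E(\mathcal{H})$. -}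

module Defs where

open import Data.Nat.Base using (ℕ)
open import Data.Fin.Base using (Fin)
open import Data.Fin.Subset using (Subset; ∣_∣)
open import Data.Fin.Subset.Properties using (_∈?_)
open import Data.List.Base using (List; length; filter)
open import Data.List.Relation.Unary.All using (All)
open import Data.List.Relation.Unary.Unique.Propositional using (Unique)
open import Data.List.Relation.Binary.Subset.Propositional using (_⊆_)
open import Relation.Binary.PropositionalEquality using (_≡_)

-- The vertex set is Fin n.  The edge set is a duplicate-free list (no
-- multiple edges); the order of the list carries no meaning.
record Hypergraph (n : ℕ) : Set where
  field
    edges  : List (Subset n)
    unique : Unique edges

open Hypergraph public

Uniform : {n : ℕ} → ℕ → Hypergraph n → Set
Uniform r H = All (λ e → ∣ e ∣ ≡ r) (edges H)

degree : {n : ℕ} → Hypergraph n → Fin n → ℕ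
degree H v = length (filter (v ∈?_) (edges H))

Regular : {n : ℕ} → ℕ → Hypergraph n → Set
Regular d H = ∀ v → degree H v ≡ d

-- Equality of the vertex sets is enforced by the shared index n.  The list
-- relation _⊆_ is inclusion of members, irrespective of order.
SpanningSubhypergraph : {n : ℕ} → Hypergraph n → Hypergraph n → Set
SpanningSubhypergraph C H = edges C ⊆ edges H

{-# OPTIONS --safe #-}

-- Round a fractional edge weighting x with values in [0,1], starting from the
-- constant x = (k+1)/d, for which the weights at every vertex sum to k+1.
-- Call a vertex safe once every rounding of the fractional edges leaves its
-- degree in [k,k+2]; an unsafe vertex of sum k+1 has at least three
-- fractional edges.  Consider the incidence matrix of unsafe vertices against
-- fractional edges.  If it has a kernel vector, moving x along it keeps the
-- sums of the unsafe vertices and makes some edge integral.  Otherwise the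
-- edges can be matched injectively to incident unsafe vertices, and since
-- every edge has three vertices, double counting forces every unsafe vertex
-- to be matched and to have exactly three fractional edges.  It then suffices
-- that at each unsafe vertex one edge goes a prescribed way, which its
-- matched edge does.
module Submission where

open import Defs
open import Data.Nat.Base using (ℕ; _+_; _≤_)
open import Data.Fin.Base using (Fin)
open import Data.Product.Base using (∃-syntax; _×_)
open import Data.Sum.Base using (_⊎_)
open import Relation.Binary.PropositionalEquality using (_≡_)

open import Algebra.Properties.Semiring.Sum as SemiringSum using ()
open import Data.Fin.Base using (zero; suc)
open import Data.Fin.Properties using (any?; suc-injective) renaming (_≟_ to _≟ᶠ_)
open import Data.Fin.Subset using (Subset; inside; outside; ∣_∣)
open import Data.Fin.Subset.Properties using (_∈?_)
open import Data.Integer.Base as ℤ using (ℤ; 0ℤ; 1ℤ; -_)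
import Data.Integer.Properties as ℤ
open import Data.Integer.Solver using (module +-*-Solver)
open import Data.List.Base using (List; []; _∷_; length; filter; lookup)
open import Data.List.Membership.Propositional.Properties using (∈-lookup)
open import Data.List.Relation.Binary.Sublist.Propositional as Sublist using (_∷ʳ_) renaming (_⊆_ to _⊑_)
open import Data.List.Relation.Binary.Sublist.Propositional.Properties using (All-resp-⊆)
open import Data.List.Relation.Unary.All as All using ()
open import Data.List.Relation.Unary.AllPairs as AllPairs using (AllPairs)
open import Data.Maybe.Base using (Maybe; just; nothing)
import Data.Maybe.Properties as Maybe
open import Data.Nat.Base as ℕ using (zero; suc; _<_; _∸_; _*_; s≤s; z≤n)
open import Data.Nat.Induction using (<-wellFounded)
import Data.Nat.Properties as ℕ
open import Data.Nat.Solver using () renaming (module +-*-Solver to ℕ-Solver)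
open import Data.Product.Base using (_,_; proj₁; proj₂)
open import Data.Sum.Base using (inj₁; inj₂; [_,_]′)
open import Data.Vec.Base using ([]; _∷_)
open import Function.Base using (_∘_; id)
open import Induction.WellFounded using (Acc; acc)
open import Level using (0ℓ)
open import Relation.Binary.PropositionalEquality
  using (_≢_; refl; sym; trans; cong; cong₂; subst; subst₂; module ≡-Reasoning)
open import Relation.Nullary using (¬_; Dec; yes; no; ¬?; contradiction; _×-dec_; _⊎-dec_)
open import Relation.Nullary.Decidable using (decidable-stable)
open import Relation.Unary using (Pred; Decidable)

open SemiringSum ℕ.+-*-semiring using () renaming
  ( sum to Σℕ; sum-cong-≗ to Σℕ-cong; ∑-distrib-+ to Σℕ-distrib-+; ∑-comm to Σℕ-comm
  ; *-distribˡ-sum to *-distribˡ-Σℕ; *-distribʳ-sum to *-distribʳ-Σℕ)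
open SemiringSum ℤ.+-*-semiring using () renaming
  (sum to Σℤ; sum-cong-≗ to Σℤ-cong; ∑-distrib-+ to Σℤ-distrib-+; *-distribˡ-sum to *-distribˡ-Σℤ)

-- Finite sums of naturals and integers.

Σℕ-zero : ∀ {n} {f : Fin n → ℕ} → (∀ i → f i ≡ 0) → Σℕ f ≡ 0
Σℕ-zero {zero}  _   = refl
Σℕ-zero {suc _} f≡0 = cong₂ _+_ (f≡0 zero) (Σℕ-zero (f≡0 ∘ suc))

Σℕ-mono-≤ : ∀ {n} {f g : Fin n → ℕ} → (∀ i → f i ≤ g i) → Σℕ f ≤ Σℕ g
Σℕ-mono-≤ {zero}  f≤g = ℕ.z≤n
Σℕ-mono-≤ {suc n} f≤g = ℕ.+-mono-≤ (f≤g zero) (Σℕ-mono-≤ (f≤g ∘ suc))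

Σℕ-mono-< : ∀ {n} {f g : Fin n → ℕ} → (∀ i → f i ≤ g i) → ∀ i → f i < g i → Σℕ f < Σℕ g
Σℕ-mono-< f≤g zero    lt = ℕ.+-mono-<-≤ lt (Σℕ-mono-≤ (f≤g ∘ suc))
Σℕ-mono-< f≤g (suc i) lt = ℕ.+-mono-≤-< (f≤g zero) (Σℕ-mono-< (f≤g ∘ suc) i lt)

-- A strict inequality in a single term would make the total strict. This is the equality case of
-- the later double count.
Σℕ-squeeze : ∀ {n} {f g : Fin n → ℕ} → (∀ i → f i ≤ g i) → Σℕ g ≤ Σℕ f → ∀ i → g i ≤ f i
Σℕ-squeeze f≤g Σg≤Σf i = ℕ.≮⇒≥ λ fi<gi → ℕ.<⇒≱ (Σℕ-mono-< f≤g i fi<gi) Σg≤Σf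

term≤Σℕ : ∀ {n} (f : Fin n → ℕ) i → f i ≤ Σℕ f
term≤Σℕ f zero    = ℕ.m≤m+n _ _
term≤Σℕ f (suc i) = ℕ.≤-trans (term≤Σℕ (f ∘ suc) i) (ℕ.m≤n+m _ (f zero))

Σℕ-combine : ∀ {n} (w x y : Fin n → ℕ) p q →
  Σℕ (λ i → w i * (p * x i + q * y i)) ≡ p * Σℕ (λ i → w i * x i) + q * Σℕ (λ i → w i * y i)
Σℕ-combine w x y p q = begin
  Σℕ (λ i → w i * (p * x i + q * y i))
    ≡⟨ Σℕ-cong (λ i → solve 5 (λ w x y p q →
         w :* (p :* x :+ q :* y) := p :* (w :* x) :+ q :* (w :* y)) refl (w i) (x i) (y i) p q) ⟩
  Σℕ (λ i → p * (w i * x i) + q * (w i * y i))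
    ≡⟨ Σℕ-distrib-+ (λ i → p * (w i * x i)) _ ⟩
  Σℕ (λ i → p * (w i * x i)) + Σℕ (λ i → q * (w i * y i))
    ≡⟨ cong₂ _+_ (*-distribˡ-Σℕ p (λ i → w i * x i)) (*-distribˡ-Σℕ q (λ i → w i * y i)) ⟨
  p * Σℕ (λ i → w i * x i) + q * Σℕ (λ i → w i * y i) ∎
  where
  open ≡-Reasoning
  open ℕ-Solver

Σℤ-zero : ∀ {n} {f : Fin n → ℤ} → (∀ i → f i ≡ 0ℤ) → Σℤ f ≡ 0ℤ
Σℤ-zero {zero}  f≡0 = refl
Σℤ-zero {suc n} f≡0 = cong₂ ℤ._+_ (f≡0 zero) (Σℤ-zero (f≡0 ∘ suc))

Σℤ-combine : ∀ {n} (w x y : Fin n → ℤ) p q →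
  Σℤ (λ i → w i ℤ.* (p ℤ.* x i ℤ.+ q ℤ.* y i)) ≡
  p ℤ.* Σℤ (λ i → w i ℤ.* x i) ℤ.+ q ℤ.* Σℤ (λ i → w i ℤ.* y i)
Σℤ-combine w x y p q = begin
  Σℤ (λ i → w i ℤ.* (p ℤ.* x i ℤ.+ q ℤ.* y i))
    ≡⟨ Σℤ-cong (λ i → solve 5 (λ w x y p q →
         w :* (p :* x :+ q :* y) := p :* (w :* x) :+ q :* (w :* y)) refl (w i) (x i) (y i) p q) ⟩
  Σℤ (λ i → p ℤ.* (w i ℤ.* x i) ℤ.+ q ℤ.* (w i ℤ.* y i))
    ≡⟨ Σℤ-distrib-+ (λ i → p ℤ.* (w i ℤ.* x i)) _ ⟩
  Σℤ (λ i → p ℤ.* (w i ℤ.* x i)) ℤ.+ Σℤ (λ i → q ℤ.* (w i ℤ.* y i))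
    ≡⟨ cong₂ ℤ._+_ (*-distribˡ-Σℤ p (λ i → w i ℤ.* x i)) (*-distribˡ-Σℤ q (λ i → w i ℤ.* y i)) ⟨
  p ℤ.* Σℤ (λ i → w i ℤ.* x i) ℤ.+ q ℤ.* Σℤ (λ i → w i ℤ.* y i) ∎
  where
  open ≡-Reasoning
  open +-*-Solver

+-Σ : ∀ {n} (f : Fin n → ℕ) → ℤ.+ Σℕ f ≡ Σℤ (λ i → ℤ.+ f i)
+-Σ {zero}  f = refl
+-Σ {suc n} f = trans (ℤ.pos-+ (f zero) _) (cong (ℤ._+_ (ℤ.+ f zero)) (+-Σ (f ∘ suc)))

nonzero-term : ∀ {n} (f : Fin n → ℤ) → Σℤ f ≢ 0ℤ → ∃[ i ] f i ≢ 0ℤ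
nonzero-term f Σf≢0 with any? (λ i → ¬? (f i ℤ.≟ 0ℤ))
... | yes found = found
... | no  none  = contradiction
  (Σℤ-zero λ i → decidable-stable (f i ℤ.≟ 0ℤ) λ fi≢0 → none (i , fi≢0)) Σf≢0

-- Kernel vectors and systems of distinct representatives.

infix 8 _·_
_·_ : ∀ {m} → (Fin m → ℤ) → (Fin m → ℤ) → ℤ
w · x = Σℤ λ c → w c ℤ.* x c

record KernelVector {n m} (M : Fin n → Fin m → ℤ) (S : Pred (Fin m) 0ℓ) : Set where
  field
    vec       : Fin m → ℤ
    nonzero   : ∃[ c ] vec c ≢ 0ℤ
    supported : ∀ {c} → ¬ S c → vec c ≡ 0ℤ
    kernel    : ∀ r → M r · vec ≡ 0ℤ

-- The map runs from rows to columns, so distinct columns have distinct rows by construction;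
-- `injective` says that a column has only one row.
record Matching {n m} (M : Fin n → Fin m → ℤ) (S : Pred (Fin m) 0ℓ) : Set where
  field
    partner   : Fin n → Maybe (Fin m)
    sound     : ∀ {r c} → partner r ≡ just c → S c × M r c ≢ 0ℤ
    covers    : ∀ {c} → S c → ∃[ r ] partner r ≡ just c
    injective : ∀ {r r′ c} → partner r ≡ just c → partner r′ ≡ just c → r ≡ r′

open KernelVector
open Matching

unit-kernel : ∀ {m} {M : Fin 0 → Fin m → ℤ} {S : Pred (Fin m) 0ℓ} {c} → S c → KernelVector M S
unit-kernel {m} {M} {S} {c} c∈S = record
  { vec = λ c′ → δ (c′ ≟ᶠ c) ; nonzero = c , δ≢0 (c ≟ᶠ c) refl
  ; supported = λ {c′} → vanishes (c′ ≟ᶠ c) ; kernel = λ () }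
  where
  δ : ∀ {P : Set} → Dec P → ℤ
  δ (yes _) = 1ℤ
  δ (no _)  = 0ℤ
  δ≢0 : ∀ {P : Set} (P? : Dec P) → P → δ P? ≢ 0ℤ
  δ≢0 (yes _) p ()
  δ≢0 (no ¬p) p = contradiction p ¬p
  vanishes : ∀ {c′} (d : Dec (c′ ≡ c)) → ¬ S c′ → δ d ≡ 0ℤ
  vanishes (yes refl) c∉S = contradiction c∈S c∉S
  vanishes (no _)     _   = refl

module _ {n m} {M : Fin (suc n) → Fin m → ℤ} {S : Pred (Fin m) 0ℓ} where

  extend-kernel : (k : KernelVector (M ∘ suc) S) → M zero · vec k ≡ 0ℤ → KernelVector M S
  extend-kernel k row₀ = record
    { vec = vec k ; nonzero = nonzero k ; supported = supported k
    ; kernel = λ { zero → row₀ ; (suc r) → kernel k r } }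

  skip-row : Matching (M ∘ suc) S → Matching M S
  skip-row μ = record
    { partner   = λ { zero → nothing ; (suc r) → partner μ r }
    ; sound     = λ { {zero} () ; {suc r} eq → sound μ eq }
    ; covers    = λ c∈S → let r , eq = covers μ c∈S in suc r , eq
    ; injective = λ { {zero} () ; {suc _} {zero} _ () ; {suc _} {suc _} eq eq′ → cong suc (injective μ eq eq′) } }

  module _ (c₀ : Fin m) where

    S∖c₀ : Pred (Fin m) 0ℓ
    S∖c₀ c = S c × c ≢ c₀

    match-row : S c₀ → M zero c₀ ≢ 0ℤ → Matching (M ∘ suc) S∖c₀ → Matching M S
    match-row c₀∈S Mc₀≢0 μ = record
      { partner   = τ
      ; sound     = λ { {zero} refl → c₀∈S , Mc₀≢0
                      ; {suc r} eq → let (c∈S , _) , M≢0 = sound μ eq in c∈S , M≢0 }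
      ; covers    = λ {c} → cover c
      ; injective = inj }
      where
      τ : Fin (suc n) → Maybe (Fin m)
      τ zero    = just c₀
      τ (suc r) = partner μ r
      cover : ∀ c → S c → ∃[ r ] τ r ≡ just c
      cover c c∈S with c ≟ᶠ c₀
      ... | yes refl = zero , refl
      ... | no c≢c₀  = let r , eq = covers μ (c∈S , c≢c₀) in suc r , eq
      inj : ∀ {r r′ c} → τ r ≡ just c → τ r′ ≡ just c → r ≡ r′
      inj {zero}  {zero}  _    _   = refl
      inj {zero}  {suc _} refl eq  = contradiction refl (proj₂ (proj₁ (sound μ eq)))
      inj {suc _} {zero}  eq refl  = contradiction refl (proj₂ (proj₁ (sound μ eq)))
      inj {suc _} {suc _} eq  eq′  = cong suc (injective μ eq eq′)

    -- A combination of the two kernel vectors cancels row zero; it stays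
    -- nonzero at c₀, where y vanishes and x does not.
    eliminate : (x : KernelVector (M ∘ suc) S) (y : KernelVector (M ∘ suc) S∖c₀) →
      vec x c₀ ≢ 0ℤ → M zero · vec y ≢ 0ℤ → KernelVector M S
    eliminate x y xc₀≢0 Q≢0 = record
      { vec       = z
      ; nonzero   = c₀ , z≢0
      ; supported = λ c∉S → trans (cong₂ (λ a b → P ℤ.* a ℤ.+ (- Q) ℤ.* b)
          (supported y (c∉S ∘ proj₁)) (supported x c∉S))
          (vanish P (- Q))
      ; kernel    = λ { zero → trans (Σℤ-combine (M zero) (vec y) (vec x) P (- Q)) (cancel P Q)
                      ; (suc r) → trans (Σℤ-combine (M (suc r)) (vec y) (vec x) P (- Q))
                          (trans (cong₂ (λ a b → P ℤ.* a ℤ.+ (- Q) ℤ.* b) (kernel y r) (kernel x r))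
                            (vanish P (- Q))) } }
      where
      open +-*-Solver
      P = M zero · vec x
      Q = M zero · vec y
      z : Fin m → ℤ
      z c = P ℤ.* vec y c ℤ.+ (- Q) ℤ.* vec x c
      vanish : ∀ p q → p ℤ.* 0ℤ ℤ.+ q ℤ.* 0ℤ ≡ 0ℤ
      vanish = solve 2 (λ p q → p :* con 0ℤ :+ q :* con 0ℤ := con 0ℤ) refl
      cancel : ∀ p q → p ℤ.* q ℤ.+ (- q) ℤ.* p ≡ 0ℤ
      cancel = solve 2 (λ p q → p :* q :+ (:- q) :* p := con 0ℤ) refl
      z≡ : z c₀ ≡ - (Q ℤ.* vec x c₀)
      z≡ = trans
        (cong (λ t → P ℤ.* t ℤ.+ (- Q) ℤ.* vec x c₀) (supported y λ (_ , c₀≢c₀) → c₀≢c₀ refl))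
        (solve 3 (λ p q t → p :* con 0ℤ :+ (:- q) :* t := :- (q :* t)) refl P Q (vec x c₀))
      z≢0 : z c₀ ≢ 0ℤ
      z≢0 z≡0 = [ Q≢0 , xc₀≢0 ]′ (ℤ.i*j≡0⇒i≡0∨j≡0 Q
        (ℤ.neg-injective {Q ℤ.* vec x c₀} {0ℤ} (trans (sym z≡) z≡0)))

-- Linearly independent columns have a system of distinct representatives
-- among the rows in which they are nonzero.
kernel-or-matching : ∀ n {m} (M : Fin n → Fin m → ℤ) {S : Pred (Fin m) 0ℓ} → Decidable S →
  KernelVector M S ⊎ Matching M S
kernel-or-matching zero M S? with any? S?
... | yes (_ , c∈S) = inj₁ (unit-kernel c∈S)
... | no  empty     = inj₂ record
  { partner = λ () ; sound = λ { {()} } ; covers = λ c∈S → contradiction (_ , c∈S) empty ; injective = λ { {()} } }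
kernel-or-matching (suc n) M {S} S? with kernel-or-matching n (M ∘ suc) S?
... | inj₂ μ = inj₂ (skip-row μ)
... | inj₁ x with M zero · vec x ℤ.≟ 0ℤ
...   | yes row₀ = inj₁ (extend-kernel x row₀)
...   | no  P≢0 with nonzero-term _ P≢0
-- The pivot `c₀` is a column where row zero and `x` are both nonzero. The induction hypothesis is
-- applied again to the same rows with `c₀` struck out: a matching leaves row zero free for `c₀`,
-- and a kernel vector `y` can be combined with `x`.
...     | c₀ , t≢0 with kernel-or-matching n (M ∘ suc) (λ c → S? c ×-dec ¬? (c ≟ᶠ c₀))
...       | inj₂ μ = inj₂ (match-row c₀ c₀∈S M≢0 μ)
  where
  M≢0 : M zero c₀ ≢ 0ℤ
  M≢0 eq = t≢0 (cong (ℤ._* vec x c₀) eq)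
  c₀∈S : S c₀
  c₀∈S = decidable-stable (S? c₀) λ c₀∉S →
    t≢0 (trans (cong (M zero c₀ ℤ.*_) (supported x c₀∉S)) (ℤ.*-zeroʳ (M zero c₀)))
...       | inj₁ y with M zero · vec y ℤ.≟ 0ℤ
...         | no Q≢0 = inj₁ (eliminate c₀ x y x≢0 Q≢0)
  where
  x≢0 : vec x c₀ ≢ 0ℤ
  x≢0 eq = t≢0 (trans (cong (M zero c₀ ℤ.*_) eq) (ℤ.*-zeroʳ (M zero c₀)))
...         | yes row₀ = inj₁ (extend-kernel record
  { vec = vec y ; nonzero = nonzero y ; supported = λ c∉S → supported y (c∉S ∘ proj₁) ; kernel = kernel y } row₀)

-- The longest move that keeps all weights in [0,1].

-- Minimises `b i / y i` over the positive `y i`, with fractions cross-multiplied. Where `y i` is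
-- zero the inequality has left side zero.
minimal-ratio : ∀ {m} (b y : Fin m → ℕ) {i} → 0 < y i →
  ∃[ j ] (0 < y j × ∀ i → b j * y i ≤ b i * y j)
minimal-ratio {suc m} b y {i} yi>0 with any? (λ i → 0 ℕ.<? y (suc i))
... | no none = zero , y₀>0 i yi>0 , λ { zero → ℕ.≤-refl ; (suc i) → vanishing i }
  where
  y₀>0 : ∀ i → 0 < y i → 0 < y zero
  y₀>0 zero    p = p
  y₀>0 (suc i) p = contradiction (i , p) none
  vanishing : ∀ i → b zero * y (suc i) ≤ b (suc i) * y zero
  vanishing i rewrite ℕ.n≤0⇒n≡0 (ℕ.≮⇒≥ λ p → none (i , p)) | ℕ.*-zeroʳ (b zero) = z≤n
... | yes (_ , p) with minimal-ratio (b ∘ suc) (y ∘ suc) p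
...   | j , yj>0 , min with b (suc j) * y zero ℕ.≤? b zero * y (suc j)
...     | yes le = suc j , yj>0 , λ { zero → le ; (suc i) → min i }
...     | no ¬le = zero , y₀>0 , λ { zero → ℕ.≤-refl ; (suc i) → transitive i }
  where
  lt : b zero * y (suc j) < b (suc j) * y zero
  lt = ℕ.≰⇒> ¬le
  y₀>0 : 0 < y zero
  y₀>0 = ℕ.n≢0⇒n>0 λ y₀≡0 → ℕ.n≮0 (subst (b zero * y (suc j) <_)
    (trans (cong (b (suc j) *_) y₀≡0) (ℕ.*-zeroʳ (b (suc j)))) lt)
  transitive : ∀ i → b zero * y (suc i) ≤ b (suc i) * y zero
  transitive i = ℕ.*-cancelʳ-≤ _ _ (y (suc j)) {{ℕ.>-nonZero yj>0}} (begin
    b zero * y (suc i) * y (suc j)    ≡⟨ swap (b zero) (y (suc i)) (y (suc j)) ⟩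
    b zero * y (suc j) * y (suc i)    ≤⟨ ℕ.*-monoˡ-≤ (y (suc i)) (ℕ.<⇒≤ lt) ⟩
    b (suc j) * y zero * y (suc i)    ≡⟨ swap (b (suc j)) (y zero) (y (suc i)) ⟩
    b (suc j) * y (suc i) * y zero    ≤⟨ ℕ.*-monoˡ-≤ (y zero) (min i) ⟩
    b (suc i) * y (suc j) * y zero    ≡⟨ swap (b (suc i)) (y (suc j)) (y zero) ⟩
    b (suc i) * y zero * y (suc j)    ∎)
    where
    open ℕ.≤-Reasoning
    swap : ∀ p q r → p * q * r ≡ p * r * q
    swap = ℕ-Solver.solve 3 (λ p q r → p :* q :* r := p :* r :* q) refl
      where open ℕ-Solver

-- The entry a / D moves to (y a + s z) / (y D); it stays in [0,1] as long as
-- s / y is at most slack / ∣z∣.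
slack : ℕ → ℕ → ℤ → ℕ
slack D a (ℤ.+ _)    = D ∸ a
slack D a ℤ.-[1+ _ ] = a

step : ℕ → ℕ → ℕ → ℤ → ℕ
step y s a (ℤ.+ n)    = y * a + s * n
step y s a ℤ.-[1+ n ] = y * a ∸ s * suc n

step-zero : ∀ {y s a z} → z ≡ 0ℤ → step y s a z ≡ y * a
step-zero {y} {s} {a} refl = trans (cong (y * a +_) (ℕ.*-zeroʳ s)) (ℕ.+-identityʳ _)

module _ {D a : ℕ} (a≤D : a ≤ D) where

  step-≤ : ∀ {y s} z → s * ℤ.∣ z ∣ ≤ slack D a z * y → step y s a z ≤ y * D
  step-≤ {y} {s} (ℤ.+ n) le = begin
    y * a + s * n        ≤⟨ ℕ.+-monoʳ-≤ (y * a) le ⟩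
    y * a + (D ∸ a) * y  ≡⟨ cong (y * a +_) (ℕ.*-comm (D ∸ a) y) ⟩
    y * a + y * (D ∸ a)  ≡⟨ ℕ.*-distribˡ-+ y a (D ∸ a) ⟨
    y * (a + (D ∸ a))    ≡⟨ cong (y *_) (ℕ.m+[n∸m]≡n a≤D) ⟩
    y * D                ∎
    where open ℕ.≤-Reasoning
  step-≤ {y} {s} ℤ.-[1+ n ] _ = ℕ.≤-trans (ℕ.m∸n≤m (y * a) (s * suc n)) (ℕ.*-monoʳ-≤ y a≤D)

  -- For negative `z` the slack bound reads `s * suc n ≤ a * y`, so the truncated subtraction in
  -- `step` is a true one.
  step-affine : ∀ {y s} z → s * ℤ.∣ z ∣ ≤ slack D a z * y →
    ℤ.+ step y s a z ≡ ℤ.+ y ℤ.* ℤ.+ a ℤ.+ ℤ.+ s ℤ.* z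
  step-affine {y} {s} (ℤ.+ n) _ = trans (ℤ.pos-+ (y * a) (s * n)) (cong₂ ℤ._+_ (ℤ.pos-* y a) (ℤ.pos-* s n))
  step-affine {y} {s} ℤ.-[1+ n ] le = begin
    ℤ.+ (y * a ∸ s * suc n)                       ≡⟨ ℤ.⊖-≥ (subst (s * suc n ≤_) (ℕ.*-comm a y) le) ⟨
    (y * a) ℤ.⊖ (s * suc n)                       ≡⟨ ℤ.m-n≡m⊖n (y * a) (s * suc n) ⟨
    ℤ.+ (y * a) ℤ.- ℤ.+ (s * suc n)               ≡⟨ cong₂ ℤ._-_ (ℤ.pos-* y a) (ℤ.pos-* s (suc n)) ⟩
    ℤ.+ y ℤ.* ℤ.+ a ℤ.- ℤ.+ s ℤ.* ℤ.+ suc n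
      ≡⟨ cong (ℤ._+_ (ℤ.+ y ℤ.* ℤ.+ a)) (ℤ.neg-distribʳ-* (ℤ.+ s) (ℤ.+ suc n)) ⟩
    ℤ.+ y ℤ.* ℤ.+ a ℤ.+ ℤ.+ s ℤ.* ℤ.-[1+ n ]      ∎
    where open ≡-Reasoning

  -- An entry moved by the ratio of its own slack to its own `∣ z ∣` uses up that slack: it ends at
  -- 1 when moving up and at 0 when moving down.
  step-extreme : ∀ z → step ℤ.∣ z ∣ (slack D a z) a z ≡ 0 ⊎ step ℤ.∣ z ∣ (slack D a z) a z ≡ ℤ.∣ z ∣ * D
  step-extreme (ℤ.+ n) = inj₂ (begin
    n * a + (D ∸ a) * n  ≡⟨ cong (n * a +_) (ℕ.*-comm (D ∸ a) n) ⟩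
    n * a + n * (D ∸ a)  ≡⟨ ℕ.*-distribˡ-+ n a (D ∸ a) ⟨
    n * (a + (D ∸ a))    ≡⟨ cong (n *_) (ℕ.m+[n∸m]≡n a≤D) ⟩
    n * D                ∎)
    where open ≡-Reasoning
  step-extreme ℤ.-[1+ n ] = inj₁ (ℕ.m≤n⇒m∸n≡0 (ℕ.≤-reflexive (ℕ.*-comm (suc n) a)))

-- Iverson brackets and the three states of a weight.

⟦_⟧ : ∀ {P : Set} → Dec P → ℕ
⟦ yes _ ⟧ = 1
⟦ no _ ⟧  = 0

⟦⟧-yes : ∀ {P : Set} (P? : Dec P) → P → ⟦ P? ⟧ ≡ 1
⟦⟧-yes (yes _) p = refl
⟦⟧-yes (no ¬p) p = contradiction p ¬p

⟦⟧-no : ∀ {P : Set} (P? : Dec P) → ¬ P → ⟦ P? ⟧ ≡ 0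
⟦⟧-no (yes p) ¬p = contradiction p ¬p
⟦⟧-no (no _)  ¬p = refl

Σℕ-unique : ∀ {n} {P : Pred (Fin n) 0ℓ} (P? : Decidable P) → (∀ {i j} → P i → P j → i ≡ j) →
  Σℕ (λ i → ⟦ P? i ⟧) ≤ 1
Σℕ-unique {zero}  P? unique = z≤n
Σℕ-unique {suc n} P? unique with P? zero
... | yes p = ℕ.≤-reflexive (cong suc (Σℕ-zero λ i → ⟦⟧-no (P? (suc i)) λ q → contradiction (unique p q) λ ()))
... | no _  = Σℕ-unique (P? ∘ suc) λ p q → suc-injective (unique p q)

Fractional : ℕ → ℕ → Set
Fractional D a = 0 < a × a < D

fractional? : ∀ D a → Dec (Fractional D a)
fractional? D a = (0 ℕ.<? a) ×-dec (a ℕ.<? D)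

-- The last two indices are the indicators of weight 1 and of fractional weight, so matching on a
-- constructor fixes both.
data Status (D a : ℕ) : ℕ → ℕ → Set where
  out  : a ≡ 0 → Status D a 0 0
  full : a ≡ D → Status D a 1 0
  frac : Fractional D a → Status D a 0 1

status : ∀ {D a} → a ≤ D → Status D a ⟦ a ℕ.≟ D ⟧ ⟦ fractional? D a ⟧
status {D} {a} a≤D with a ℕ.≟ D | fractional? D a
... | yes refl | yes (_ , a<a) = contradiction refl (ℕ.<⇒≢ a<a)
... | yes a≡D  | no _          = full a≡D
... | no _     | yes f         = frac f
... | no a≢D   | no ¬f         = out (ℕ.n≤0⇒n≡0 (ℕ.≮⇒≥ λ a>0 → ¬f (a>0 , ℕ.≤∧≢⇒< a≤D a≢D)))

module _ {D a i j : ℕ} where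

  -- A fractional numerator is at least 1. The term `1 * j` keeps this gain through summation, and
  -- its coefficient fits `Σℕ-combine`.
  status-lower : Status D a i j → D * i + 1 * j ≤ a
  status-lower (out refl)       = ℕ.≤-reflexive (trans (ℕ.+-identityʳ _) (ℕ.*-zeroʳ D))
  status-lower (full refl)      = ℕ.≤-reflexive (trans (ℕ.+-identityʳ _) (ℕ.*-identityʳ D))
  status-lower (frac (a>0 , _)) = ℕ.≤-trans (ℕ.≤-reflexive (cong (_+ 1) (ℕ.*-zeroʳ D))) a>0

  -- A fractional numerator is at least 1 below `D`, which leaves room for `1 * j` on the left.
  status-upper : Status D a i j → 1 * a + 1 * j ≤ D * i + D * j
  status-upper (out refl)       = z≤n
  status-upper (full refl)      = ℕ.≤-trans
    (ℕ.≤-reflexive (trans (ℕ.+-identityʳ _) (ℕ.*-comm 1 D))) (ℕ.m≤m+n _ _)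
  status-upper (frac (_ , a<D)) = ℕ.≤-trans
    (ℕ.≤-trans (ℕ.≤-reflexive (trans (ℕ.+-comm _ 1) (cong suc (ℕ.*-identityˡ a)))) a<D)
    (ℕ.≤-trans (ℕ.≤-reflexive (sym (ℕ.*-identityʳ D))) (ℕ.m≤n+m _ _))

  module _ {D′ a′ i′ j′ : ℕ} (D′>0 : 0 < D′) (a≡0⇒ : a ≡ 0 → a′ ≡ 0) (a≡D⇒ : a ≡ D → a′ ≡ D′) where

    -- Integral entries keep their value, so only a fractional entry can change its state. Hence the
    -- least degree reachable by rounding never falls and the greatest never rises.
    status-mono : Status D a i j → Status D′ a′ i′ j′ → i ≤ i′ × i′ + j′ ≤ i + j × j′ ≤ j
    status-mono (out refl) t with a≡0⇒ refl | t
    ... | refl | out _           = z≤n , z≤n , z≤n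
    ... | refl | full refl       = contradiction refl (ℕ.<⇒≢ D′>0)
    ... | refl | frac (() , _)
    status-mono (full refl) t with a≡D⇒ refl | t
    ... | refl | out refl        = contradiction refl (ℕ.<⇒≢ D′>0)
    ... | refl | full _          = s≤s z≤n , s≤s z≤n , z≤n
    ... | refl | frac (_ , D<D)  = contradiction refl (ℕ.<⇒≢ D<D)
    status-mono (frac _) (out _)  = z≤n , z≤n , z≤n
    status-mono (frac _) (full _) = z≤n , s≤s z≤n , z≤n
    status-mono (frac _) (frac _) = z≤n , s≤s z≤n , s≤s z≤n

-- The fractional vector num / den.
record Weighting (m : ℕ) : Set where
  field
    den     : ℕ
    num     : Fin m → ℕ
    den>0   : 0 < den
    num≤den : ∀ e → num e ≤ den

  Frac : Pred (Fin m) 0ℓ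
  Frac e = Fractional den (num e)

  frac? : Decidable Frac
  frac? e = fractional? den (num e)

  ones fracs : Fin m → ℕ
  ones  e = ⟦ num e ℕ.≟ den ⟧
  fracs e = ⟦ frac? e ⟧

  statuses : ∀ e → Status den (num e) (ones e) (fracs e)
  statuses e = status (num≤den e)

open Weighting

-- Rounding for a matrix `A` of vertices against edges.

module Rounding {n m : ℕ} (A : Fin n → Fin m → ℕ) (k : ℕ) where

  infix 8 _⊙_
  _⊙_ : Fin n → (Fin m → ℕ) → ℕ
  v ⊙ x = Σℕ λ e → A v e * x e

  ⊙-mono-≤ : ∀ v {x y} → (∀ e → x e ≤ y e) → v ⊙ x ≤ v ⊙ y
  ⊙-mono-≤ v x≤y = Σℕ-mono-≤ λ e → ℕ.*-monoʳ-≤ (A v e) (x≤y e)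

  ⊙-mono-< : ∀ v {x y} → (∀ e → x e ≤ y e) → ∀ e → A v e ≢ 0 → x e < y e → v ⊙ x < v ⊙ y
  ⊙-mono-< v x≤y e A≢0 lt = Σℕ-mono-< (λ e → ℕ.*-monoʳ-≤ (A v e) (x≤y e)) e
    (ℕ.*-monoʳ-< (A v e) {{ℕ.≢-nonZero A≢0}} lt)

  ⊙-+ : ∀ v x y → v ⊙ (λ e → x e + y e) ≡ v ⊙ x + v ⊙ y
  ⊙-+ v x y = trans (Σℕ-cong λ e → ℕ.*-distribˡ-+ (A v e) (x e) (y e)) (Σℕ-distrib-+ (λ e → A v e * x e) _)

  -- Rounding all fractional edges down gives degree `lo W v`; rounding them all up gives
  -- `lo W v + fl W v`.
  lo fl : Weighting m → Fin n → ℕ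
  lo W v = v ⊙ ones W
  fl W v = v ⊙ fracs W

  -- Any rounding of the fractional edges leaves the degree of a safe v in [k,k+2];
  -- at a tight v the weights num / den sum to k+1.
  Safe Tight : Weighting m → Fin n → Set
  Safe W v  = k ≤ lo W v × lo W v + fl W v ≤ 2 + k
  Tight W v = v ⊙ num W ≡ den W * suc k

  safe? : ∀ W v → Dec (Safe W v)
  safe? W v = (k ℕ.≤? lo W v) ×-dec (lo W v + fl W v ℕ.≤? 2 + k)

  module _ (W : Weighting m) {v : Fin n} (tight : Tight W v) where

    private
      D = den W
      instance _ = ℕ.>-nonZero (den>0 W)

    tight-lower : D * lo W v + 1 * fl W v ≤ D * suc k
    tight-lower = begin
      D * lo W v + 1 * fl W v                         ≡⟨ Σℕ-combine (A v) (ones W) (fracs W) D 1 ⟨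
      v ⊙ (λ e → D * ones W e + 1 * fracs W e)        ≤⟨ ⊙-mono-≤ v (status-lower ∘ statuses W) ⟩
      v ⊙ num W                                       ≡⟨ tight ⟩
      D * suc k                                       ∎
      where open ℕ.≤-Reasoning

    tight-upper : D * suc k + 1 * fl W v ≤ D * (lo W v + fl W v)
    tight-upper = begin
      D * suc k + 1 * fl W v                          ≡⟨ cong (_+ 1 * fl W v) (trans (ℕ.*-identityˡ _) tight) ⟨
      1 * (v ⊙ num W) + 1 * fl W v                    ≡⟨ Σℕ-combine (A v) (num W) (fracs W) 1 1 ⟨
      v ⊙ (λ e → 1 * num W e + 1 * fracs W e)         ≤⟨ ⊙-mono-≤ v (status-upper ∘ statuses W) ⟩
      v ⊙ (λ e → D * ones W e + D * fracs W e)        ≡⟨ Σℕ-combine (A v) (ones W) (fracs W) D D ⟩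
      D * lo W v + D * fl W v                         ≡⟨ ℕ.*-distribˡ-+ D (lo W v) (fl W v) ⟨
      D * (lo W v + fl W v)                           ∎
      where open ℕ.≤-Reasoning

    -- If `fl W v` is positive, both bounds become strict and `suc k` lies strictly between `lo W v`
    -- and `lo W v + fl W v`; otherwise all three coincide.
    tight-cases : (fl W v ≡ 0 × lo W v ≡ suc k) ⊎ (lo W v ≤ k × 2 + k ≤ lo W v + fl W v)
    tight-cases with fl W v | tight-lower | tight-upper
    ... | zero  | l | u = inj₁ (refl , ℕ.≤-antisym
      (ℕ.*-cancelˡ-≤ D (subst (_≤ D * suc k) (ℕ.+-identityʳ _) l))
      (ℕ.*-cancelˡ-≤ D (subst₂ _≤_ (ℕ.+-identityʳ _) (cong (D *_) (ℕ.+-identityʳ _)) u)))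
    ... | suc f | l | u = inj₂
      ( ℕ.s≤s⁻¹ (ℕ.*-cancelˡ-< D _ _ (ℕ.<-≤-trans (ℕ.m<m+n _ (s≤s z≤n)) l))
      , ℕ.*-cancelˡ-< D _ _ (ℕ.<-≤-trans (ℕ.m<m+n _ (s≤s z≤n)) u))

    -- The degree range has length `fl W v` and contains `suc k` in its interior. If that length is
    -- at most 2, the range lies within [k,k+2] and the vertex is safe.
    unsafe-bounds : ¬ Safe W v → lo W v ≤ k × 2 + k ≤ lo W v + fl W v × 3 ≤ fl W v
    unsafe-bounds ¬safe with tight-cases
    ... | inj₁ (f≡0 , l≡1+k) = contradiction
      ( ℕ.≤-trans (ℕ.n≤1+n k) (ℕ.≤-reflexive (sym l≡1+k))
      , ℕ.≤-trans (ℕ.≤-reflexive (trans (cong (lo W v +_) f≡0) (trans (ℕ.+-identityʳ _) l≡1+k)))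
          (ℕ.n≤1+n (suc k))) ¬safe
    ... | inj₂ (l≤k , 2+k≤l+f) = l≤k , 2+k≤l+f , ℕ.≰⇒> λ f≤2 → ¬safe
      ( ℕ.+-cancelˡ-≤ 2 _ _ (ℕ.≤-trans 2+k≤l+f (ℕ.≤-trans (ℕ.+-monoʳ-≤ (lo W v) f≤2)
          (ℕ.≤-reflexive (ℕ.+-comm (lo W v) 2))))
      , ℕ.≤-trans (ℕ.+-mono-≤ l≤k f≤2) (ℕ.≤-reflexive (ℕ.+-comm k 2)))

  -- The invariant of the iteration: a vertex may lose tightness only once it is safe.
  Balanced : Weighting m → Set
  Balanced W = ∀ v → Safe W v ⊎ Tight W v

  restrict : ∀ {P : Set} → Dec P → ℕ → ℤ
  restrict (yes _) _ = 0ℤ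
  restrict (no _)  a = ℤ.+ a

  -- Rows of safe vertices are set to zero instead of being deleted, which keeps the index type
  -- `Fin n`. A zero row constrains no kernel vector and can be no edge's partner.
  unsafeRows : Weighting m → Fin n → Fin m → ℤ
  unsafeRows W v e = restrict (safe? W v) (A v e)

  -- Moving along a kernel vector.

  module Advance (W : Weighting m) (balanced : Balanced W) (K : KernelVector (unsafeRows W) (Frac W)) where
    open KernelVector K
      renaming (vec to z; nonzero to z≢0; supported to z-supported; kernel to M·z≡0)

    private
      D = den W
      a = num W

    sl : Fin m → ℕ
    sl e = slack D (a e) (z e)

    -- The edge `e*` that first exhausts its slack determines the step length `s / y`.
    tightest : ∃[ j ] (0 < ℤ.∣ z j ∣ × ∀ i → sl j * ℤ.∣ z i ∣ ≤ sl i * ℤ.∣ z j ∣)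
    tightest = minimal-ratio sl (λ e → ℤ.∣ z e ∣) {proj₁ z≢0}
      (ℕ.n≢0⇒n>0 (proj₂ z≢0 ∘ ℤ.∣i∣≡0⇒i≡0))

    e* = proj₁ tightest
    y = ℤ.∣ z e* ∣
    s = sl e*
    y>0 = proj₁ (proj₂ tightest)
    within : ∀ e → s * ℤ.∣ z e ∣ ≤ sl e * y
    within = proj₂ (proj₂ tightest)

    moved : Fin m → ℕ
    moved e = step y s (a e) (z e)

    W′ : Weighting m
    W′ = record { den = y * D ; num = moved ; den>0 = ℕ.*-mono-≤ y>0 (den>0 W)
                ; num≤den = λ e → step-≤ (num≤den W e) (z e) (within e) }

    mono : ∀ e → ones W e ≤ ones W′ e × ones W′ e + fracs W′ e ≤ ones W e + fracs W e × fracs W′ e ≤ fracs W e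
    mono e = status-mono (den>0 W′)
      -- An integral entry lies outside the support of `z`, so its numerator is only rescaled along
      -- with the denominator.
      (λ a≡0 → trans (step-zero {y} {s} {a e} (z-supported λ (a>0 , _) → ℕ.<⇒≢ a>0 (sym a≡0)))
        (trans (cong (y *_) a≡0) (ℕ.*-zeroʳ y)))
      (λ a≡D → trans (step-zero {y} {s} {a e} (z-supported λ (_ , a<D) → ℕ.<⇒≢ a<D a≡D))
        (cong (y *_) a≡D))
      (statuses W e) (statuses W′ e)

    extreme : ¬ Frac W′ e*
    extreme (pos , small) = [ (λ eq → ℕ.<⇒≢ pos (sym eq)) , ℕ.<⇒≢ small ]′ (step-extreme (num≤den W e*) (z e*))

    e*-frac : Frac W e*
    e*-frac with frac? W e*
    ... | yes f = f
    ... | no ¬f = contradiction (sym (cong ℤ.∣_∣ (z-supported ¬f))) (ℕ.<⇒≢ y>0)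

    -- No edge becomes fractional, and `e*` ceases to be so. This is the termination measure.
    fewer : Σℕ (fracs W′) < Σℕ (fracs W)
    fewer = Σℕ-mono-< (λ e → proj₂ (proj₂ (mono e))) e*
      (subst₂ _<_ (sym (⟦⟧-no (frac? W′ e*) extreme)) (sym (⟦⟧-yes (frac? W e*) e*-frac)) (s≤s z≤n))

    safe′ : ∀ {v} → Safe W v → Safe W′ v
    safe′ {v} (k≤l , u≤) = ℕ.≤-trans k≤l (⊙-mono-≤ v (proj₁ ∘ mono)) , (begin
      lo W′ v + fl W′ v                      ≡⟨ ⊙-+ v (ones W′) (fracs W′) ⟨
      v ⊙ (λ e → ones W′ e + fracs W′ e)     ≤⟨ ⊙-mono-≤ v (λ e → proj₁ (proj₂ (mono e))) ⟩
      v ⊙ (λ e → ones W e + fracs W e)       ≡⟨ ⊙-+ v (ones W) (fracs W) ⟩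
      lo W v + fl W v                        ≤⟨ u≤ ⟩
      2 + k                                  ∎)
      where open ℕ.≤-Reasoning

    kernel′ : ∀ {v} → ¬ Safe W v → (λ e → ℤ.+ A v e) · z ≡ 0ℤ
    kernel′ {v} ¬safe with safe? W v | M·z≡0 v
    ... | yes safe | _  = contradiction safe ¬safe
    ... | no _     | eq = eq

    +-⊙ : ∀ v x → ℤ.+ (v ⊙ x) ≡ (λ e → ℤ.+ A v e) · (λ e → ℤ.+ x e)
    +-⊙ v x = trans (+-Σ (λ e → A v e * x e)) (Σℤ-cong λ e → ℤ.pos-* (A v e) (x e))

    -- The row of an unsafe vertex annihilates `z`, so its weighted sum is merely multiplied by `y`,
    -- as is the denominator.
    tight′ : ∀ {v} → ¬ Safe W v → Tight W v → Tight W′ v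
    tight′ {v} ¬safe tight = ℤ.+-injective (begin
      ℤ.+ (v ⊙ moved)                                       ≡⟨ +-⊙ v moved ⟩
      Av · (λ e → ℤ.+ moved e)
        ≡⟨ Σℤ-cong (λ e → cong (ℤ.+ A v e ℤ.*_) (step-affine (num≤den W e) (z e) (within e))) ⟩
      Av · (λ e → ℤ.+ y ℤ.* ℤ.+ a e ℤ.+ ℤ.+ s ℤ.* z e)      ≡⟨ Σℤ-combine Av (λ e → ℤ.+ a e) z (ℤ.+ y) (ℤ.+ s) ⟩
      ℤ.+ y ℤ.* Av · (λ e → ℤ.+ a e) ℤ.+ ℤ.+ s ℤ.* Av · z
        ≡⟨ cong₂ (λ p q → ℤ.+ y ℤ.* p ℤ.+ ℤ.+ s ℤ.* q) (sym (+-⊙ v a)) (kernel′ ¬safe) ⟩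
      ℤ.+ y ℤ.* ℤ.+ (v ⊙ a) ℤ.+ ℤ.+ s ℤ.* 0ℤ
        ≡⟨ cong₂ ℤ._+_ (sym (ℤ.pos-* y (v ⊙ a))) (ℤ.*-zeroʳ (ℤ.+ s)) ⟩
      ℤ.+ (y * v ⊙ a) ℤ.+ 0ℤ                                ≡⟨ ℤ.+-identityʳ _ ⟩
      ℤ.+ (y * v ⊙ a)                                       ≡⟨ cong (λ t → ℤ.+ (y * t)) tight ⟩
      ℤ.+ (y * (D * suc k))                                 ≡⟨ cong ℤ.+_ (ℕ.*-assoc y D (suc k)) ⟨
      ℤ.+ (y * D * suc k)                                   ∎)
      where
      open ≡-Reasoning
      Av : Fin m → ℤ
      Av e = ℤ.+ A v e

    balanced′ : Balanced W′
    balanced′ v with safe? W v | balanced v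
    ... | yes safe | _          = inj₁ (safe′ safe)
    ... | no ¬safe | inj₁ safe  = contradiction safe ¬safe
    ... | no ¬safe | inj₂ tight = inj₂ (tight′ ¬safe tight)

  -- Rounding everything once a matching exists.

  module Finish (uniform : ∀ e → Σℕ (λ v → A v e) ≡ 3) (W : Weighting m) (balanced : Balanced W)
                (μ : Matching (unsafeRows W) (Frac W)) where
    open Matching μ
      renaming (partner to τ; sound to τ-sound; covers to τ-covers; injective to τ-injective)

    matched? : ∀ v e → Dec (τ v ≡ just e)
    matched? v e = Maybe.≡-dec _≟ᶠ_ (τ v) (just e)

    -- A matched entry is nonzero, whereas the rows of safe vertices vanish.
    unsafe : ∀ {v e} → τ v ≡ just e → ¬ Safe W v × A v e ≢ 0
    unsafe {v} {e} eq with safe? W v | proj₂ (τ-sound eq)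
    ... | yes _    | M≢0 = contradiction refl M≢0
    ... | no ¬safe | M≢0 = ¬safe , λ A≡0 → M≢0 (cong ℤ.+_ A≡0)

    bounds : ∀ {v} → ¬ Safe W v → lo W v ≤ k × 2 + k ≤ lo W v + fl W v × 3 ≤ fl W v
    bounds {v} ¬safe with balanced v
    ... | inj₁ safe  = contradiction safe ¬safe
    ... | inj₂ tight = unsafe-bounds W tight ¬safe

    matchings : Fin n → ℕ
    matchings v = Σℕ λ e → ⟦ matched? v e ⟧

    unmatched : ∀ {v} → τ v ≡ nothing → matchings v ≡ 0
    unmatched {v} eq = Σℕ-zero λ e → ⟦⟧-no (matched? v e) λ eq′ → contradiction (trans (sym eq) eq′) λ ()

    matchings≤1 : ∀ v → matchings v ≤ 1
    matchings≤1 v = Σℕ-unique (matched? v) λ p q → Maybe.just-injective (trans (sym p) q)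

    -- A matched vertex is unsafe and therefore has `fl W v` at least 3.
    3matchings≤fl : ∀ v → 3 * matchings v ≤ fl W v
    3matchings≤fl v = by (τ v) refl
      where
      by : ∀ t → τ v ≡ t → 3 * matchings v ≤ fl W v
      by nothing  eq = ℕ.≤-trans (ℕ.≤-reflexive (cong (3 *_) (unmatched eq))) z≤n
      by (just e) eq = ℕ.≤-trans (ℕ.*-monoʳ-≤ 3 (matchings≤1 v)) (proj₂ (proj₂ (bounds (proj₁ (unsafe eq)))))

    fracs≤matchings : Σℕ (fracs W) ≤ Σℕ matchings
    fracs≤matchings = ℕ.≤-trans (Σℕ-mono-≤ covered)
      (ℕ.≤-reflexive (Σℕ-comm λ e v → ⟦ matched? v e ⟧))
      where
      covered : ∀ e → fracs W e ≤ Σℕ λ v → ⟦ matched? v e ⟧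
      covered e with frac? W e
      ... | no _  = z≤n
      ... | yes f = let v , eq = τ-covers f in
        ℕ.≤-trans (ℕ.≤-reflexive (sym (⟦⟧-yes (matched? v e) eq))) (term≤Σℕ _ v)

    -- Double counting of incidences between vertices and fractional edges.
    Σfl : Σℕ (fl W) ≡ 3 * Σℕ (fracs W)
    Σfl = begin
      Σℕ (λ v → Σℕ λ e → A v e * fracs W e)  ≡⟨ Σℕ-comm (λ v e → A v e * fracs W e) ⟩
      Σℕ (λ e → Σℕ λ v → A v e * fracs W e)  ≡⟨ Σℕ-cong (λ e → *-distribʳ-Σℕ (fracs W e) (λ v → A v e)) ⟨
      Σℕ (λ e → Σℕ (λ v → A v e) * fracs W e)  ≡⟨ Σℕ-cong (λ e → cong (_* fracs W e) (uniform e)) ⟩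
      Σℕ (λ e → 3 * fracs W e)               ≡⟨ *-distribˡ-Σℕ 3 (fracs W) ⟨
      3 * Σℕ (fracs W)                       ∎
      where open ≡-Reasoning

    -- Every fractional edge is matched, so the totals of `3 * matchings v` and `fl W v` agree, and
    -- the termwise bound is an equality.
    fl≤3matchings : ∀ v → fl W v ≤ 3 * matchings v
    fl≤3matchings = Σℕ-squeeze 3matchings≤fl (begin
      Σℕ (fl W)                    ≡⟨ Σfl ⟩
      3 * Σℕ (fracs W)             ≤⟨ ℕ.*-monoʳ-≤ 3 fracs≤matchings ⟩
      3 * Σℕ matchings             ≡⟨ *-distribˡ-Σℕ 3 matchings ⟩
      Σℕ (λ v → 3 * matchings v)   ∎)
      where open ℕ.≤-Reasoning

    -- An unmatched vertex would have `fl W v` zero, against the lower bound 3 for unsafe vertices.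
    partner-of : ∀ {v} → ¬ Safe W v → ∃[ e ] (τ v ≡ just e × fl W v ≤ 3)
    partner-of {v} ¬safe = by (τ v) refl
      where
      by : ∀ t → τ v ≡ t → ∃[ e ] (τ v ≡ just e × fl W v ≤ 3)
      by nothing  eq = contradiction
        (ℕ.≤-trans (proj₂ (proj₂ (bounds ¬safe)))
          (ℕ.≤-trans (fl≤3matchings v) (ℕ.≤-reflexive (cong (3 *_) (unmatched eq))))) λ ()
      by (just e) eq = e , eq , ℕ.≤-trans (fl≤3matchings v) (ℕ.*-monoʳ-≤ 3 (matchings≤1 v))

    -- At an unsafe vertex `lo W v` is `k - 1` or `k`. Its matched edge is taken in the first case
    -- and left out in the second; the other fractional edges there may go either way.
    Chosen : Pred (Fin m) 0ℓ
    Chosen e = num W e ≡ den W ⊎ ∃[ v ] (τ v ≡ just e × lo W v < k)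

    chosen? : Decidable Chosen
    chosen? e = (num W e ℕ.≟ den W) ⊎-dec any? λ v → matched? v e ×-dec (lo W v ℕ.<? k)

    chosen : Fin m → ℕ
    chosen e = ⟦ chosen? e ⟧

    ones≤chosen : ∀ e → ones W e ≤ chosen e
    ones≤chosen e with num W e ℕ.≟ den W
    ... | yes _ = s≤s z≤n
    ... | no _  = z≤n

    chosen≤ones+fracs : ∀ e → chosen e ≤ ones W e + fracs W e
    chosen≤ones+fracs e = by (chosen? e)
      where
      by : (c : Dec (Chosen e)) → ⟦ c ⟧ ≤ ones W e + fracs W e
      by (no _)         = z≤n
      by (yes (inj₁ eq)) = ℕ.≤-trans (ℕ.≤-reflexive (sym (⟦⟧-yes (num W e ℕ.≟ den W) eq))) (ℕ.m≤m+n _ _)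
      by (yes (inj₂ (_ , eq , _))) = ℕ.≤-trans
        (ℕ.≤-reflexive (sym (⟦⟧-yes (frac? W e) (proj₁ (τ-sound eq))))) (ℕ.m≤n+m _ (ones W e))

    chosen-lower : ∀ v → lo W v ≤ v ⊙ chosen
    chosen-lower v = ⊙-mono-≤ v ones≤chosen

    chosen-upper : ∀ v → v ⊙ chosen ≤ lo W v + fl W v
    chosen-upper v = ℕ.≤-trans (⊙-mono-≤ v chosen≤ones+fracs) (ℕ.≤-reflexive (⊙-+ v (ones W) (fracs W)))

    rounded : ∀ v → k ≤ v ⊙ chosen × v ⊙ chosen ≤ 2 + k
    rounded v with safe? W v
    ... | yes (k≤lo , hi≤2+k) = ℕ.≤-trans k≤lo (chosen-lower v) , ℕ.≤-trans (chosen-upper v) hi≤2+k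
    ... | no ¬safe with partner-of ¬safe | bounds ¬safe | lo W v ℕ.<? k
    -- Here `lo W v + 3` is `k + 2`, so only the lower bound is at stake, and taking `e` raises the
    -- degree above `lo W v`.
    ...   | e , eq , fl≤3 | _ , 2+k≤ , _ | yes lo<k =
        ℕ.≤-trans k≤1+lo (⊙-mono-< v ones≤chosen e (proj₂ (unsafe eq)) ones<chosen)
      , ℕ.≤-trans (chosen-upper v) (ℕ.≤-trans (ℕ.+-monoʳ-≤ (lo W v) fl≤3)
          (ℕ.≤-trans (ℕ.≤-reflexive (ℕ.+-comm (lo W v) 3)) (ℕ.+-monoʳ-≤ 2 lo<k)))
      where
      k≤1+lo : k ≤ suc (lo W v)
      k≤1+lo = ℕ.+-cancelˡ-≤ 2 _ _ (ℕ.≤-trans 2+k≤ (ℕ.≤-trans (ℕ.+-monoʳ-≤ (lo W v) fl≤3)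
        (ℕ.≤-reflexive (ℕ.+-comm (lo W v) 3))))
      ones<chosen : ones W e < chosen e
      ones<chosen = subst₂ _<_
        (sym (⟦⟧-no (num W e ℕ.≟ den W) (ℕ.<⇒≢ (proj₂ (proj₁ (τ-sound eq))))))
        (sym (⟦⟧-yes (chosen? e) (inj₂ (v , eq , lo<k)))) (s≤s z≤n)
    -- Here `lo W v` is `k`, so only the upper bound is at stake: the degree could reach `k + 3`,
    -- and omitting `e` prevents this.
    ...   | e , eq , fl≤3 | lo≤k , _ , _ | no lo≮k =
        ℕ.≤-trans (ℕ.≮⇒≥ lo≮k) (chosen-lower v)
      , ℕ.s≤s⁻¹ (ℕ.<-≤-trans (⊙-mono-< v chosen≤ones+fracs e (proj₂ (unsafe eq)) chosen<)
          (ℕ.≤-trans (ℕ.≤-reflexive (⊙-+ v (ones W) (fracs W)))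
            (ℕ.≤-trans (ℕ.+-mono-≤ lo≤k fl≤3) (ℕ.≤-reflexive (ℕ.+-comm k 3)))))
      where
      isFrac = proj₁ (τ-sound eq)
      ¬chosen : ¬ Chosen e
      ¬chosen (inj₁ a≡D)             = ℕ.<⇒≢ (proj₂ isFrac) a≡D
      -- By injectivity `v` is the only vertex that could have claimed `e`.
      ¬chosen (inj₂ (v′ , eq′ , lt)) = lo≮k (subst (λ u → lo W u < k) (τ-injective eq′ eq) lt)
      chosen< : chosen e < ones W e + fracs W e
      chosen< = subst₂ _<_ (sym (⟦⟧-no (chosen? e) ¬chosen))
        (sym (cong₂ _+_ (⟦⟧-no (num W e ℕ.≟ den W) (ℕ.<⇒≢ (proj₂ isFrac))) (⟦⟧-yes (frac? W e) isFrac)))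
        (s≤s z≤n)

  record Selection : Set₁ where
    field
      {Chosen} : Pred (Fin m) 0ℓ
      chosen?  : Decidable Chosen
      bounds   : ∀ v → k ≤ v ⊙ (λ e → ⟦ chosen? e ⟧) × v ⊙ (λ e → ⟦ chosen? e ⟧) ≤ 2 + k

  -- Each kernel vector lowers the number of fractional edges, so the recursion ends at a matching.
  round : (∀ e → Σℕ (λ v → A v e) ≡ 3) → ∀ (W : Weighting m) → Balanced W → Selection
  round uniform W balanced = go W balanced (<-wellFounded _)
    where
    go : ∀ W → Balanced W → Acc _<_ (Σℕ (fracs W)) → Selection
    go W balanced (acc rec) with kernel-or-matching n (unsafeRows W) (frac? W)
    ... | inj₂ μ = record { chosen? = F.chosen? ; bounds = F.rounded }
      where module F = Finish uniform W balanced μ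
    ... | inj₁ K = go A′.W′ A′.balanced′ (rec A′.fewer)
      where module A′ = Advance W balanced K

-- From selected positions to sublists and degrees.

module _ {A : Set} where

  select : (xs : List A) {P : Pred (Fin (length xs)) 0ℓ} → Decidable P → List A
  select []       P? = []
  select (x ∷ xs) P? with P? zero
  ... | yes _ = x ∷ select xs (P? ∘ suc)
  ... | no _  = select xs (P? ∘ suc)

  -- The order-preserving sublist relation yields both inclusion of members and the absence of
  -- duplicates.
  select-⊑ : ∀ xs {P : Pred (Fin (length xs)) 0ℓ} (P? : Decidable P) → select xs P? ⊑ xs
  select-⊑ []       P? = Sublist.[]
  select-⊑ (x ∷ xs) P? with P? zero
  ... | yes _ = refl Sublist.∷ select-⊑ xs (P? ∘ suc)
  ... | no _  = x ∷ʳ select-⊑ xs (P? ∘ suc)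

  AllPairs-resp-⊑ : ∀ {R : A → A → Set} {xs ys} → xs ⊑ ys → AllPairs R ys → AllPairs R xs
  AllPairs-resp-⊑ Sublist.[]         AllPairs.[]         = AllPairs.[]
  AllPairs-resp-⊑ (_ ∷ʳ τ)           (_ AllPairs.∷ rs)   = AllPairs-resp-⊑ τ rs
  AllPairs-resp-⊑ (refl Sublist.∷ τ) (r AllPairs.∷ rs)   = All-resp-⊆ τ r AllPairs.∷ AllPairs-resp-⊑ τ rs

  module _ {Q : Pred A 0ℓ} (Q? : Decidable Q) where

    length-filter : ∀ xs → length (filter Q? xs) ≡ Σℕ (λ i → ⟦ Q? (lookup xs i) ⟧)
    length-filter []       = refl
    length-filter (x ∷ xs) with Q? x
    ... | yes _ = cong suc (length-filter xs)
    ... | no _  = length-filter xs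

    length-filter-select : ∀ xs {P : Pred (Fin (length xs)) 0ℓ} (P? : Decidable P) →
      length (filter Q? (select xs P?)) ≡ Σℕ (λ i → ⟦ Q? (lookup xs i) ⟧ * ⟦ P? i ⟧)
    length-filter-select []       P? = refl
    length-filter-select (x ∷ xs) P? with P? zero
    ... | no _  = trans (length-filter-select xs (P? ∘ suc))
      (cong (_+ Σℕ λ i → ⟦ Q? (lookup xs i) ⟧ * ⟦ P? (suc i) ⟧) (sym (ℕ.*-zeroʳ ⟦ Q? x ⟧)))
    ... | yes _ with Q? x
    ...   | yes _ = cong suc (length-filter-select xs (P? ∘ suc))
    ...   | no _  = length-filter-select xs (P? ∘ suc)

⟦there-∈?⟧ : ∀ {n} s (p : Subset n) v → ⟦ v ∈? p ⟧ ≡ ⟦ suc v ∈? s ∷ p ⟧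
⟦there-∈?⟧ s p v with v ∈? p
... | yes _ = refl
... | no _  = refl

∣p∣≡Σ : ∀ {n} (p : Subset n) → ∣ p ∣ ≡ Σℕ (λ v → ⟦ v ∈? p ⟧)
∣p∣≡Σ []            = refl
∣p∣≡Σ (inside ∷ p)  = cong suc (trans (∣p∣≡Σ p) (Σℕ-cong (⟦there-∈?⟧ inside p)))
∣p∣≡Σ (outside ∷ p) = trans (∣p∣≡Σ p) (Σℕ-cong (⟦there-∈?⟧ outside p))

-- Assembling the theorem.

between : ∀ k {x} → k ≤ x → x ≤ 2 + k → x ≡ k ⊎ x ≡ k + 1 ⊎ x ≡ k + 2
between k {x} k≤x x≤2+k with ℕ.m≤n⇒m<n∨m≡n k≤x
... | inj₂ k≡x = inj₁ (sym k≡x)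
... | inj₁ k<x with ℕ.m≤n⇒m<n∨m≡n k<x
...   | inj₂ 1+k≡x = inj₂ (inj₁ (trans (sym 1+k≡x) (ℕ.+-comm 1 k)))
...   | inj₁ 1+k<x = inj₂ (inj₂ (trans (ℕ.≤-antisym x≤2+k 1+k<x) (ℕ.+-comm 2 k)))

constant : ∀ m d k → k < d → Weighting m
constant m d k k<d = record
  { den = d ; num = λ _ → suc k ; den>0 = ℕ.≤-trans (s≤s z≤n) k<d ; num≤den = λ _ → k<d }

theorem1p3 : (d k : ℕ) → k ≤ d → 1 ≤ k →
    (n : ℕ) (H : Hypergraph n) → Regular d H → Uniform 3 H →
    ∃[ C ] (SpanningSubhypergraph C H ×
    ((v : Fin n) → degree C v ≡ k ⊎ degree C v ≡ k + 1 ⊎ degree C v ≡ k + 2))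
theorem1p3 d k k≤d _ n H regular uniform with ℕ.m≤n⇒m<n∨m≡n k≤d
-- For `k` equal to `d` the weight `(k + 1) / d` would exceed 1, but `H` itself has all degrees `k`.
... | inj₂ refl = H , id , inj₁ ∘ regular
... | inj₁ k<d  = C , Sublist.lookup (select-⊑ (edges H) chosen?) , λ v →
    let k≤deg , deg≤2+k = subst (λ δ → k ≤ δ × δ ≤ 2 + k)
          (sym (length-filter-select (v ∈?_) (edges H) chosen?)) (bounds v)
    in between k k≤deg deg≤2+k
  where
  A : Fin n → Fin (length (edges H)) → ℕ
  A v e = ⟦ v ∈? lookup (edges H) e ⟧

  open Rounding A k

  W : Weighting (length (edges H))
  W = constant _ d k k<d

  -- The constant numerator `suc k` summed over the `d` edges at `v` gives `d * suc k`, and the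
  -- denominator is `d`.
  tight : ∀ v → Tight W v
  tight v = trans (sym (*-distribʳ-Σℕ (suc k) (A v)))
    (cong (_* suc k) (trans (sym (length-filter (v ∈?_) (edges H))) (regular v)))

  three-vertices : ∀ e → Σℕ (λ v → A v e) ≡ 3
  three-vertices e = trans (sym (∣p∣≡Σ (lookup (edges H) e))) (All.lookup uniform (∈-lookup e))

  open Selection (round three-vertices W (inj₂ ∘ tight))

  C : Hypergraph n
  C = record
    { edges  = select (edges H) chosen?
    ; unique = AllPairs-resp-⊑ (select-⊑ (edges H) chosen?) (unique H)
    }
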